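{- Let $G$ be an ordered abelian group and $H \subsetneq G$ a convex subgroup. Write $\Gamma := v_G(G\setminus\{0\})$ and $\Gamma_H := v_G(H\setminus\{0\})$. (1) If $\Gamma \setminus \Gamma_H$ has a maximum and there is an integer $n \geq 2$ such that $G/H$ has no non-trivial $n$-divisible convex subgroup, then $H$ is $\mathcal{L}_{\mathrm{og}}$-definable in $G$. (2) If for some integer $n \geq 2$ the quotient $G/H$ has a non-trivial $n$-divisible convex subgroup, $\Gamma_H$ does not have a minimum, and for every convex subgroup $H' \subsetneq H$ the quotient $H/H'$ is not $n$-divisible, then $H$ is $\mathcal{L}_{\mathrm{og}}$-definable in $G$. (3) If for some integer $n \geq 2$ the quotient $G/H$ has no non-trivial convex $n$-divisible subgroup and $\Gamma_H$ has a minimum, then $H$ is $\mathcal{L}_{\mathrm{og}}$-definable in $G$. (4) If for some integer $n \geq 2$ the quotient $G/H$ has no non-trivial convex $n$-divisible subgroup and for some convex subgroup $H' \subsetneq H$ the quotient $H/H'$ is $n$-divisible, then $H$ is $\mathcal{L}_{\mathrm{og}}$-definable in $G$.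
   Context: All orderings are linear. $\mathcal{L}_{\mathrm{og}}=\{+,-,0,<\}$ is the language of ordered groups, and "definable" means first-order definable with parameters from the structure. Two elements $a,b \in G$ are archimedean equivalent, $a\sim b$, if there is $n\in\mathbb{N}=\{1,2,\dots\}$ with $|a|\le n|b|$ and $|b|\le n|a|$; $[a]_+$ denotes the equivalence class of $a$. The set of classes is ordered by $[a]_+<[b]_+ :\Leftrightarrow |a|>|b|$ and $a\not\sim b$. The natural valuation on $G$ is $v_G\colon a\mapsto [a]_+$. Quotients by convex subgroups carry the induced ordering. -}

module Defs where

open import Level using (Level; suc) renaming (_⊔_ to _⊔ᴸ_)
open import Algebra.Bundles using (AbelianGroup)
open import Algebra.Structures using (IsAbelianGroup)
open import Data.Empty.Polymorphic using (⊥)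
open import Data.Fin.Base using (Fin)
open import Data.Nat.Base as ℕ using (ℕ)
open import Data.Product.Base using (Σ; ∃; ∃-syntax; _×_; _,_; proj₁; proj₂)
open import Data.Sum.Base using (_⊎_; inj₁; inj₂; map)
open import Data.Vec.Base using (Vec; _∷_; lookup)
open import Function.Bundles using (_⇔_)
open import Relation.Binary.Bundles using (TotalOrder)
open import Relation.Binary.Core using (Rel)
open import Relation.Binary.Structures using (IsTotalOrder)
open import Relation.Nullary.Negation.Core using (¬_)
open import Relation.Unary using (Pred; _∈_)

import Algebra.Construct.NaturalChoice.Max as Max
import Algebra.Definitions.RawMonoid as RawMonoid
import Algebra.Properties.AbelianGroup as AbelianGroupProperties
import Algebra.Properties.CommutativeSemigroup as CommutativeSemigroupProperties
import Relation.Binary.Construct.NonStrictToStrict as ToStrict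
import Relation.Binary.Construct.On as On
import Relation.Binary.Reasoning.Setoid as SetoidReasoning

private
  variable
    ℓ : Level

------------------------------------------------------------------------
-- Ordered abelian groups

-- The single level ℓ plays the role of the universe of sets: a subset of
-- a group is any predicate at that level.
record OrderedAbelianGroup (ℓ : Level) : Set (suc ℓ) where
  infix  8 -_
  infixl 6 _+_
  infix  4 _≈_ _≤_
  field
    Carrier        : Set ℓ
    _≈_            : Rel Carrier ℓ
    _≤_            : Rel Carrier ℓ
    _+_            : Carrier → Carrier → Carrier
    0#             : Carrier
    -_             : Carrier → Carrier
    isAbelianGroup : IsAbelianGroup _≈_ _+_ 0# -_
    isTotalOrder   : IsTotalOrder _≈_ _≤_
    +-monoˡ-≤      : ∀ z {x y} → x ≤ y → x + z ≤ y + z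

  abelianGroup : AbelianGroup ℓ ℓ
  abelianGroup = record { isAbelianGroup = isAbelianGroup }

  totalOrder : TotalOrder ℓ ℓ ℓ
  totalOrder = record { isTotalOrder = isTotalOrder }

  open ToStrict _≈_ _≤_ public using (_<_)
  open Max totalOrder public using (_⊔_)
  open RawMonoid (AbelianGroup.rawMonoid abelianGroup) public
    using () renaming (_×_ to _·_)

  ∣_∣ : Carrier → Carrier
  ∣ x ∣ = x ⊔ (- x)

Divisible : ℕ → OrderedAbelianGroup ℓ → Set ℓ
Divisible n G = ∀ x → ∃[ y ] n · y ≈ x
  where open OrderedAbelianGroup G

------------------------------------------------------------------------
-- Convex subgroups

record ConvexSubgroup (G : OrderedAbelianGroup ℓ) : Set (suc ℓ) where
  open OrderedAbelianGroup G
  field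
    Member   : Pred Carrier ℓ
    resp     : ∀ {x y} → x ≈ y → x ∈ Member → y ∈ Member
    0-closed : 0# ∈ Member
    +-closed : ∀ {x y} → x ∈ Member → y ∈ Member → (x + y) ∈ Member
    -‿closed : ∀ {x} → x ∈ Member → (- x) ∈ Member
    convex   : ∀ {x y z} → x ≤ y → y ≤ z → x ∈ Member → z ∈ Member → y ∈ Member

open ConvexSubgroup public using (Member)

NonTrivial : {G : OrderedAbelianGroup ℓ} → ConvexSubgroup G → Set ℓ
NonTrivial {G = G} H = ∃[ x ] x ∈ Member H × ¬ x ≈ 0#
  where open OrderedAbelianGroup G

-- A convex subgroup as an ordered abelian group in its own right.
⟨_⟩ : {G : OrderedAbelianGroup ℓ} → ConvexSubgroup G → OrderedAbelianGroup ℓ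
⟨_⟩ {G = G} H = record
  { Carrier        = Σ Carrier (Member H)
  ; _≈_            = λ x y → proj₁ x ≈ proj₁ y
  ; _≤_            = λ x y → proj₁ x ≤ proj₁ y
  ; _+_            = λ x y → proj₁ x + proj₁ y , +-closed (proj₂ x) (proj₂ y)
  ; 0#             = 0# , 0-closed
  ; -_             = λ x → - proj₁ x , -‿closed (proj₂ x)
  ; isAbelianGroup = record
    { isGroup = record
      { isMonoid = record
        { isSemigroup = record
          { isMagma = record
            { isEquivalence = On.isEquivalence proj₁ isEquivalence
            ; ∙-cong        = ∙-cong
            }
          ; assoc = λ x y z → assoc (proj₁ x) (proj₁ y) (proj₁ z)
          }
        ; identity = (λ x → identityˡ (proj₁ x)) , (λ x → identityʳ (proj₁ x))
        }
      ; inverse = (λ x → inverseˡ (proj₁ x)) , (λ x → inverseʳ (proj₁ x))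
      ; ⁻¹-cong = ⁻¹-cong
      }
    ; comm = λ x y → comm (proj₁ x) (proj₁ y)
    }
  ; isTotalOrder   = On.isTotalOrder proj₁ isTotalOrder
  ; +-monoˡ-≤      = λ z → +-monoˡ-≤ (proj₁ z)
  }
  where
  open OrderedAbelianGroup G
  open ConvexSubgroup H hiding (Member)
  open IsAbelianGroup isAbelianGroup
    using (isEquivalence; ∙-cong; assoc; identityˡ; identityʳ; inverseˡ; inverseʳ; ⁻¹-cong; comm)

-- K ∩ H as a convex subgroup of H; this is K itself when K ⊆ H.
_↾_ : {G : OrderedAbelianGroup ℓ} (K H : ConvexSubgroup G) → ConvexSubgroup ⟨ H ⟩
K ↾ H = record
  { Member   = λ x → proj₁ x ∈ Member K
  ; resp     = resp
  ; 0-closed = 0-closed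
  ; +-closed = +-closed
  ; -‿closed = -‿closed
  ; convex   = convex
  }
  where open ConvexSubgroup K hiding (Member)

-- The quotient has the same carrier, with cosets compared as
--   x + H = y + H  iff  x - y ∈ H,
--   x + H ≤ y + H  iff  x ≤ y + h for some h ∈ H.
infixl 7 _/_
_/_ : (G : OrderedAbelianGroup ℓ) → ConvexSubgroup G → OrderedAbelianGroup ℓ
_/_ {ℓ} G H = record
  { Carrier        = Carrier
  ; _≈_            = _≈ᴴ_
  ; _≤_            = _≤ᴴ_
  ; _+_            = _+_
  ; 0#             = 0#
  ; -_             = -_
  ; isAbelianGroup = record
    { isGroup = record
      { isMonoid = record
        { isSemigroup = record
          { isMagma = record
            { isEquivalence = record
              { refl  = λ {x} → ≈⇒≈ᴴ refl
              ; sym   = λ {x} {y} p → resp (⁻¹-anti-homo‿- x y) (-‿closed p)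
              ; trans = λ {x} {y} {z} p q → resp (telescope x y z) (+-closed p q)
              }
            ; ∙-cong = λ {x} {x′} {y} {y′} p q → resp (+-diff x x′ y y′) (+-closed p q)
            }
          ; assoc = λ x y z → ≈⇒≈ᴴ (assoc x y z)
          }
        ; identity = (λ x → ≈⇒≈ᴴ (identityˡ x)) , (λ x → ≈⇒≈ᴴ (identityʳ x))
        }
      ; inverse = (λ x → ≈⇒≈ᴴ (inverseˡ x)) , (λ x → ≈⇒≈ᴴ (inverseʳ x))
      ; ⁻¹-cong = λ {x} {y} p → resp (sym (⁻¹-∙-comm x (- y))) (-‿closed p)
      }
    ; comm = λ x y → ≈⇒≈ᴴ (comm x y)
    }
  ; isTotalOrder   = record
    { isPartialOrder = record
      { isPreorder = record
        { isEquivalence = record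
          { refl  = λ {x} → ≈⇒≈ᴴ refl
          ; sym   = λ {x} {y} p → resp (⁻¹-anti-homo‿- x y) (-‿closed p)
          ; trans = λ {x} {y} {z} p q → resp (telescope x y z) (+-closed p q)
          }
        ; reflexive = λ {x} {y} p → x - y , p , O.reflexive (x≈y+[x-y] x y)
        ; trans     = ≤ᴴ-trans
        }
      ; antisym = ≤ᴴ-antisym
      }
    ; total = λ x y → map ≤⇒≤ᴴ ≤⇒≤ᴴ (O.total x y)
    }
  ; +-monoˡ-≤      = λ z {x} {y} (h , h∈H , x≤y+h) →
      h , h∈H , O.trans (+-monoˡ-≤ z x≤y+h) (O.reflexive (xy∙z≈xz∙y y h z))
  }
  where
  open OrderedAbelianGroup G
  open ConvexSubgroup H hiding (Member)
  open AbelianGroup abelianGroup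
    using (_-_; refl; sym; trans; assoc; comm; identityˡ; identityʳ; inverseˡ; inverseʳ
          ; ⁻¹-cong; ∙-cong; ∙-congˡ; ∙-congʳ; setoid; commutativeSemigroup)
  open AbelianGroupProperties abelianGroup
    using (⁻¹-anti-homo‿-; ⁻¹-∙-comm; x≈y⇒x∙y⁻¹≈ε; xyx⁻¹≈y)
  open CommutativeSemigroupProperties commutativeSemigroup using (interchange; xy∙z≈xz∙y)
  open SetoidReasoning setoid
  module O = IsTotalOrder isTotalOrder

  _≈ᴴ_ : Rel Carrier ℓ
  x ≈ᴴ y = (x - y) ∈ Member H

  _≤ᴴ_ : Rel Carrier ℓ
  x ≤ᴴ y = ∃[ h ] h ∈ Member H × x ≤ y + h

  ≈⇒≈ᴴ : ∀ {x y} → x ≈ y → x ≈ᴴ y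
  ≈⇒≈ᴴ p = resp (sym (x≈y⇒x∙y⁻¹≈ε p)) 0-closed

  ≤⇒≤ᴴ : ∀ {x y} → x ≤ y → x ≤ᴴ y
  ≤⇒≤ᴴ {y = y} p = 0# , 0-closed , O.trans p (O.reflexive (sym (identityʳ y)))

  telescope : ∀ x y z → (x - y) + (y - z) ≈ x - z
  telescope x y z = begin
    (x - y) + (y - z)     ≈⟨ assoc (x - y) y (- z) ⟨
    ((x - y) + y) - z     ≈⟨ ∙-congʳ (assoc x (- y) y) ⟩
    (x + (- y + y)) - z   ≈⟨ ∙-congʳ (∙-congˡ (inverseˡ y)) ⟩
    (x + 0#) - z          ≈⟨ ∙-congʳ (identityʳ x) ⟩
    x - z                 ∎

  +-diff : ∀ x x′ y y′ → (x - x′) + (y - y′) ≈ (x + y) - (x′ + y′)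
  +-diff x x′ y y′ = begin
    (x - x′) + (y - y′)       ≈⟨ interchange x (- x′) y (- y′) ⟩
    (x + y) + (- x′ + - y′)   ≈⟨ ∙-congˡ (⁻¹-∙-comm x′ y′) ⟩
    (x + y) - (x′ + y′)       ∎

  x≈y+[x-y] : ∀ x y → x ≈ y + (x - y)
  x≈y+[x-y] x y = begin
    x             ≈⟨ xyx⁻¹≈y y x ⟨
    (y + x) - y   ≈⟨ assoc y x (- y) ⟩
    y + (x - y)   ∎

  ≤ᴴ-trans : ∀ {x y z} → x ≤ᴴ y → y ≤ᴴ z → x ≤ᴴ z
  ≤ᴴ-trans {z = z} (h , h∈H , x≤y+h) (k , k∈H , y≤z+k) =
    k + h , +-closed k∈H h∈H ,
    O.trans x≤y+h (O.trans (+-monoˡ-≤ h y≤z+k) (O.reflexive (assoc z k h)))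

  ≤+⇒-≤ : ∀ {x y h} → x ≤ y + h → x - y ≤ h
  ≤+⇒-≤ {y = y} {h} p = O.trans (+-monoˡ-≤ (- y) p) (O.reflexive (xyx⁻¹≈y y h))

  -- From y - x ≤ k, add (- k) + (x - y) to both sides.
  neg-≤ : ∀ {x y k} → y - x ≤ k → - k ≤ x - y
  neg-≤ {x} {y} {k} p =
    O.trans (O.reflexive (sym lhs)) (O.trans (+-monoˡ-≤ (- k + (x - y)) p) (O.reflexive rhs))
    where
    lhs : (y - x) + (- k + (x - y)) ≈ - k
    lhs = begin
      (y - x) + (- k + (x - y))   ≈⟨ ∙-congˡ (comm (- k) (x - y)) ⟩
      (y - x) + ((x - y) - k)     ≈⟨ assoc (y - x) (x - y) (- k) ⟨
      ((y - x) + (x - y)) - k     ≈⟨ ∙-congʳ (telescope y x y) ⟩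
      (y - y) - k                 ≈⟨ ∙-congʳ (inverseʳ y) ⟩
      0# - k                      ≈⟨ identityˡ (- k) ⟩
      - k                         ∎
    rhs : k + (- k + (x - y)) ≈ x - y
    rhs = begin
      k + (- k + (x - y))   ≈⟨ assoc k (- k) (x - y) ⟨
      (k - k) + (x - y)     ≈⟨ ∙-congʳ (inverseʳ k) ⟩
      0# + (x - y)          ≈⟨ identityˡ (x - y) ⟩
      x - y                 ∎

  ≤ᴴ-antisym : ∀ {x y} → x ≤ᴴ y → y ≤ᴴ x → x ≈ᴴ y
  ≤ᴴ-antisym (h , h∈H , x≤y+h) (k , k∈H , y≤x+k) =
    convex (neg-≤ (≤+⇒-≤ y≤x+k)) (≤+⇒-≤ x≤y+h) (-‿closed k∈H) h∈H

------------------------------------------------------------------------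
-- The natural valuation

module _ (G : OrderedAbelianGroup ℓ) where
  open OrderedAbelianGroup G

  infix 4 _~_ _≺_ _≼_

  _~_ : Rel Carrier ℓ
  a ~ b = ∃[ n ] 1 ℕ.≤ n × ∣ a ∣ ≤ n · ∣ b ∣ × ∣ b ∣ ≤ n · ∣ a ∣

  -- Archimedean classes are given by representatives, two of which denote
  -- the same class when they are related by _~_; so v is the identity on
  -- representatives, and a ≺ b means [ a ]₊ < [ b ]₊ (note the reversal).
  _≺_ : Rel Carrier ℓ
  a ≺ b = ∣ b ∣ < ∣ a ∣ × ¬ (a ~ b)

  _≼_ : Rel Carrier ℓ
  a ≼ b = a ≺ b ⊎ a ~ b

  -- The classes v(s) with 0 ≠ s ∈ S.
  v[_∖0] : ∀ {s} → Pred Carrier s → Pred Carrier (s ⊔ᴸ ℓ)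
  v[ S ∖0] a = ∃[ s ] s ∈ S × ¬ (s ≈ 0#) × s ~ a

  HasMaximum : Pred Carrier ℓ → Set ℓ
  HasMaximum Δ = ∃[ a ] a ∈ Δ × (∀ b → b ∈ Δ → b ≼ a)

  HasMinimum : Pred Carrier ℓ → Set ℓ
  HasMinimum Δ = ∃[ a ] a ∈ Δ × (∀ b → b ∈ Δ → a ≼ b)

------------------------------------------------------------------------
-- First-order logic over {+, -, 0, <}

-- k bounds the free variables; quantifiers bind de Bruijn variable 0.
data Term (k : ℕ) : Set where
  var  : Fin k → Term k
  𝟎    : Term k
  _⊕_  : Term k → Term k → Term k
  ⊖_   : Term k → Term k

data Formula (k : ℕ) : Set where
  _≐_ _⋖_        : Term k → Term k → Formula k
  ⊥′             : Formula k
  _∧′_ _∨′_ _⇒′_ : Formula k → Formula k → Formula k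
  ∀′_ ∃′_        : Formula (ℕ.suc k) → Formula k

module _ (G : OrderedAbelianGroup ℓ) where
  open OrderedAbelianGroup G

  ⟦_⟧ : ∀ {k} → Term k → Vec Carrier k → Carrier
  ⟦ var i ⟧ ρ = lookup ρ i
  ⟦ 𝟎     ⟧ ρ = 0#
  ⟦ s ⊕ t ⟧ ρ = ⟦ s ⟧ ρ + ⟦ t ⟧ ρ
  ⟦ ⊖ t   ⟧ ρ = - ⟦ t ⟧ ρ

  Sat : ∀ {k} → Formula k → Vec Carrier k → Set ℓ
  Sat (s ≐ t)  ρ = ⟦ s ⟧ ρ ≈ ⟦ t ⟧ ρ
  Sat (s ⋖ t)  ρ = ⟦ s ⟧ ρ < ⟦ t ⟧ ρ
  Sat ⊥′       ρ = ⊥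
  Sat (φ ∧′ ψ) ρ = Sat φ ρ × Sat ψ ρ
  Sat (φ ∨′ ψ) ρ = Sat φ ρ ⊎ Sat ψ ρ
  Sat (φ ⇒′ ψ) ρ = Sat φ ρ → Sat ψ ρ
  Sat (∀′ φ)   ρ = ∀ x → Sat φ (x ∷ ρ)
  Sat (∃′ φ)   ρ = ∃[ x ] Sat φ (x ∷ ρ)

  -- Definable with parameters: ps is substituted for all variables of φ
  -- but the first.
  Definable : Pred Carrier ℓ → Set ℓ
  Definable S =
    ∃[ k ] Σ (Formula (ℕ.suc k)) λ φ → Σ (Vec Carrier k) λ ps →
      ∀ x → x ∈ S ⇔ Sat φ (x ∷ ps)

{-# OPTIONS --safe #-}
module Submission where

-- Suppose that G / H has no non-trivial n-divisible convex subgroup. Then every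
-- a ∉ H archimedean-dominates some c ∉ nG + H, and subtracting from c a multiple
-- of n∣a∣ moves it into [ - n∣a∣ , n∣a∣ ]. Hence, if every element of H is within
-- ∣d∣ of nG for a fixed d ∈ H, then x ∈ H iff every y with ∣y∣ ≤ ∣nx∣ is within
-- ∣d∣ of nG; this settles (3) and (4).
-- For (1), let a represent the maximum, so that every y ∉ H dominates a. If some
-- g ∉ H satisfies ∣g∣ < ∣ny∣ for all y ∉ H, then H = { x : ∣nx∣ ≤ ∣g∣ }. Otherwise
-- every x ∉ H satisfies ∣ny∣ ≤ ∣x∣ for some y ∉ H, so that H is the set of all x
-- such that c is not within ∣x∣ of nG.
-- For (2), take g ∉ H in the n-divisible part: x ≠ 0 lies in H iff some y with
-- ∣y∣ ≤ ∣g∣ is not within ∣x∣ of nG.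

open import Defs
open import Algebra.Bundles using (AbelianGroup)
open import Axiom.DoubleNegationElimination using (em⇒dne)
open import Axiom.ExcludedMiddle using (ExcludedMiddle)
open import Data.Fin.Patterns using (0F; 1F; 2F; 3F)
open import Data.Nat.Base as ℕ using (ℕ; zero; suc; s≤s; z≤n; NonZero)
open import Data.Product.Base using (Σ; ∃-syntax; _×_; _,_; proj₁; proj₂)
open import Data.Sum.Base using (_⊎_; inj₁; inj₂; [_,_]′)
open import Data.Unit.Base using (tt)
open import Data.Vec.Base using ([]; _∷_)
open import Function.Base using (_∘_)
open import Function.Bundles using (_⇔_; mk⇔; Equivalence)
open import Level using (Level; lift; lower)
open import Relation.Binary.Bundles using (TotalOrder)
open import Relation.Binary.PropositionalEquality as ≡ using (_≡_)
open import Relation.Nullary.Decidable.Core using (Dec; yes; no)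
open import Relation.Nullary.Negation.Core using (¬_; contradiction)
open import Relation.Unary using (_∖_; _⊂_; _⊆_; _∈_; _∉_; U)

import Algebra.Construct.NaturalChoice.Max as Max
import Algebra.Properties.AbelianGroup as AbelianGroupProperties
import Algebra.Properties.CommutativeMonoid.Mult as Mult
import Relation.Binary.Reasoning.Setoid as SetoidReasoning

open Equivalence using (to; from)

private
  variable
    ℓ : Level

-- Subgroups and quotients compute with the operations of `G`, so passing to underlying elements is
-- additive up to `≡`. For a variable `n` the multiple does not reduce, hence the induction; `subst`
-- then transports memberships along it.
·-homo : (A B : OrderedAbelianGroup ℓ) →
         let module A = OrderedAbelianGroup A
             module B = OrderedAbelianGroup B in
         (f : A.Carrier → B.Carrier) →
         f A.0# ≡ B.0# → (∀ x y → f (x A.+ y) ≡ f x B.+ f y) →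
         ∀ n x → f (n A.· x) ≡ n B.· f x
·-homo A B f f-0 f-+ zero    x = f-0
·-homo A B f f-0 f-+ (suc n) x =
  ≡.trans (f-+ x _) (≡.cong (OrderedAbelianGroup._+_ B (f x)) (·-homo A B f f-0 f-+ n x))

-- Order, multiples and absolute values.

module GroupProperties (G : OrderedAbelianGroup ℓ) where
  open OrderedAbelianGroup G public
  open AbelianGroup abelianGroup public
    using (_-_; refl; sym; trans; assoc; comm; identityˡ; identityʳ; inverseʳ; setoid)
    renaming ( ∙-congˡ to +-congˡ; ∙-congʳ to +-congʳ; ⁻¹-cong to -‿cong
             ; commutativeMonoid to +-commutativeMonoid )
  open AbelianGroupProperties abelianGroup public
    using (⁻¹-anti-homo‿-; ⁻¹-∙-comm; ⁻¹-involutive; ε⁻¹≈ε; xyx⁻¹≈y; x≈y⇒x∙y⁻¹≈ε; inverseʳ-unique)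
  open Mult +-commutativeMonoid public
    using (×-distrib-+; ×-homo-+; ×-homo-1; ×-congʳ)
  open TotalOrder totalOrder public
    using (total) renaming (refl to ≤-refl; trans to ≤-trans; reflexive to ≤-reflexive)
  open Max totalOrder using (⊔-sel; ⊔-lub; ⊔-cong; ⊔-comm; x≤x⊔y; x≤y⊔x)
  open SetoidReasoning setoid

  ≤-respˡ-≈ : ∀ {x y z} → x ≈ y → x ≤ z → y ≤ z
  ≤-respˡ-≈ p = ≤-trans (≤-reflexive (sym p))

  ≤-respʳ-≈ : ∀ {x y z} → x ≈ y → z ≤ x → z ≤ y
  ≤-respʳ-≈ p q = ≤-trans q (≤-reflexive p)

  +-mono-≤ : ∀ {x y u v} → x ≤ y → u ≤ v → x + u ≤ y + v
  +-mono-≤ {x} {y} {u} {v} p q =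
    ≤-trans (+-monoˡ-≤ u p) (≤-respˡ-≈ (comm u y) (≤-respʳ-≈ (comm v y) (+-monoˡ-≤ y q)))

  x+y-y≈x : ∀ x y → x + y - y ≈ x
  x+y-y≈x x y = trans (assoc x y (- y)) (trans (+-congˡ (inverseʳ y)) (identityʳ x))

  x-[x-y]≈y : ∀ x y → x - (x - y) ≈ y
  x-[x-y]≈y x y = begin
    x - (x - y)   ≈⟨ +-congˡ (⁻¹-anti-homo‿- x y) ⟩
    x + (y - x)   ≈⟨ assoc x y (- x) ⟨
    x + y - x     ≈⟨ xyx⁻¹≈y x y ⟩
    y             ∎

  x-[y+z]≈x-y-z : ∀ x y z → x - (y + z) ≈ x - y - z
  x-[y+z]≈x-y-z x y z = begin
    x - (y + z)       ≈⟨ +-congˡ (⁻¹-∙-comm y z) ⟨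
    x + (- y + - z)   ≈⟨ assoc x (- y) (- z) ⟨
    x - y - z         ∎

  -‿anti-≤ : ∀ {x y} → x ≤ y → - y ≤ - x
  -‿anti-≤ {x} {y} p = ≤-respˡ-≈ lhs (≤-respʳ-≈ rhs (+-monoˡ-≤ (- x - y) p))
    where
    lhs : x + (- x - y) ≈ - y
    lhs = begin
      x + (- x - y)   ≈⟨ assoc x (- x) (- y) ⟨
      x - x - y       ≈⟨ +-congʳ (inverseʳ x) ⟩
      0# - y          ≈⟨ identityˡ (- y) ⟩
      - y             ∎
    rhs : y + (- x - y) ≈ - x
    rhs = trans (sym (assoc y (- x) (- y))) (xyx⁻¹≈y y (- x))

  ·-zeroʳ : ∀ n → n · 0# ≈ 0#
  ·-zeroʳ zero    = refl
  ·-zeroʳ (suc n) = trans (identityˡ _) (·-zeroʳ n)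

  ·-negʳ : ∀ n x → n · (- x) ≈ - (n · x)
  ·-negʳ n x = inverseʳ-unique (n · x) (n · (- x)) (begin
    n · x + n · (- x)   ≈⟨ ×-distrib-+ x (- x) n ⟨
    n · (x - x)         ≈⟨ ×-congʳ n (inverseʳ x) ⟩
    n · 0#              ≈⟨ ·-zeroʳ n ⟩
    0#                  ∎)

  ·-monoʳ-≤ : ∀ n {x y} → x ≤ y → n · x ≤ n · y
  ·-monoʳ-≤ zero    p = ≤-refl
  ·-monoʳ-≤ (suc n) p = +-mono-≤ p (·-monoʳ-≤ n p)

  0≤x⇒0≤n·x : ∀ n {x} → 0# ≤ x → 0# ≤ n · x
  0≤x⇒0≤n·x n p = ≤-respˡ-≈ (·-zeroʳ n) (·-monoʳ-≤ n p)

  0≤x⇒x≤n·x : ∀ n .{{_ : NonZero n}} {x} → 0# ≤ x → x ≤ n · x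
  0≤x⇒x≤n·x (suc n) {x} p = ≤-respˡ-≈ (identityʳ x) (+-mono-≤ ≤-refl (0≤x⇒0≤n·x n p))

  x≤∣x∣ : ∀ x → x ≤ ∣ x ∣
  x≤∣x∣ x = x≤x⊔y x (- x)

  -x≤∣x∣ : ∀ x → - x ≤ ∣ x ∣
  -x≤∣x∣ x = x≤y⊔x x (- x)

  ∣∣-lub : ∀ {x y} → x ≤ y → - x ≤ y → ∣ x ∣ ≤ y
  ∣∣-lub = ⊔-lub

  ∣∣-sel : ∀ x → ∣ x ∣ ≈ x ⊎ ∣ x ∣ ≈ - x
  ∣∣-sel x = ⊔-sel x (- x)

  ∣∣-cong : ∀ {x y} → x ≈ y → ∣ x ∣ ≈ ∣ y ∣
  ∣∣-cong p = ⊔-cong p (-‿cong p)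

  ∣-x∣≈∣x∣ : ∀ x → ∣ - x ∣ ≈ ∣ x ∣
  ∣-x∣≈∣x∣ x = trans (⊔-comm (- x) (- (- x))) (⊔-cong (⁻¹-involutive x) refl)

  0≤∣x∣ : ∀ x → 0# ≤ ∣ x ∣
  0≤∣x∣ x = [ (λ p → ≤-trans p (x≤∣x∣ x))
            , (λ p → ≤-trans (≤-respˡ-≈ ε⁻¹≈ε (-‿anti-≤ p)) (-x≤∣x∣ x))
            ]′ (total 0# x)

  0≤x⇒∣x∣≤x : ∀ {x} → 0# ≤ x → ∣ x ∣ ≤ x
  0≤x⇒∣x∣≤x p = ∣∣-lub ≤-refl (≤-trans (≤-respʳ-≈ ε⁻¹≈ε (-‿anti-≤ p)) p)

  ∣x+y∣≤∣x∣+∣y∣ : ∀ x y → ∣ x + y ∣ ≤ ∣ x ∣ + ∣ y ∣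
  ∣x+y∣≤∣x∣+∣y∣ x y = ∣∣-lub
    (+-mono-≤ (x≤∣x∣ x) (x≤∣x∣ y))
    (≤-respˡ-≈ (⁻¹-∙-comm x y) (+-mono-≤ (-x≤∣x∣ x) (-x≤∣x∣ y)))

  n·∣x∣≤∣n·x∣ : ∀ n x → n · ∣ x ∣ ≤ ∣ n · x ∣
  n·∣x∣≤∣n·x∣ n x =
    [ (λ p → ≤-respˡ-≈ (×-congʳ n (sym p)) (x≤∣x∣ (n · x)))
    , (λ p → ≤-respˡ-≈ (sym (trans (×-congʳ n p) (·-negʳ n x))) (-x≤∣x∣ (n · x)))
    ]′ (∣∣-sel x)

  ∣x∣≤∣n·x∣ : ∀ n .{{_ : NonZero n}} x → ∣ x ∣ ≤ ∣ n · x ∣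
  ∣x∣≤∣n·x∣ n x = ≤-trans (0≤x⇒x≤n·x n (0≤∣x∣ x)) (n·∣x∣≤∣n·x∣ n x)

  ∣x∣≤1·∣y∣ : ∀ {x y} → ∣ x ∣ ≤ ∣ y ∣ → ∣ x ∣ ≤ 1 · ∣ y ∣
  ∣x∣≤1·∣y∣ = ≤-respʳ-≈ (sym (×-homo-1 _))

  n·∣x∣≤suc-n·∣x∣ : ∀ n x → n · ∣ x ∣ ≤ suc n · ∣ x ∣
  n·∣x∣≤suc-n·∣x∣ n x = ≤-respˡ-≈ (identityˡ _) (+-monoˡ-≤ (n · ∣ x ∣) (0≤∣x∣ x))

  -- Distance to the multiples of n.

  module _ (n : ℕ) {g : Carrier} (0≤g : 0# ≤ g) where

    -- The bound is `n · g` rather than `g` because elements are reduced by translations by `n · g`,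
    -- which preserve cosets of nG.
    Near : Carrier → Set ℓ
    Near c = ∃[ z ] ∣ c - n · z ∣ ≤ n · g

    Near-resp : ∀ {c d} → c ≈ d → Near c → Near d
    Near-resp p (z , q) = z , ≤-respˡ-≈ (∣∣-cong (+-congʳ p)) q

    Near-neg : ∀ {c} → Near c → Near (- c)
    Near-neg {c} (z , q) = - z , ≤-respˡ-≈ (sym (trans (∣∣-cong eq) (∣-x∣≈∣x∣ _))) q
      where
      eq : - c - n · (- z) ≈ - (c - n · z)
      eq = trans (+-congˡ (-‿cong (·-negʳ n z))) (⁻¹-∙-comm c (- (n · z)))

    Near-small : ∀ {c} → ∣ c ∣ ≤ n · g → Near c
    Near-small {c} p = 0# , ≤-respˡ-≈ (∣∣-cong (sym eq)) p
      where
      eq : c - n · 0# ≈ c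
      eq = trans (+-congˡ (trans (-‿cong (·-zeroʳ n)) ε⁻¹≈ε)) (identityʳ c)

    Near-shift : ∀ {c} → Near (c - n · g) → Near c
    Near-shift {c} (z , q) = g + z , ≤-respˡ-≈ (∣∣-cong (sym eq)) q
      where
      eq : c - n · (g + z) ≈ c - n · g - n · z
      eq = trans (+-congˡ (-‿cong (×-distrib-+ g z n))) (x-[y+z]≈x-y-z c (n · g) (n · z))

    -- Division with remainder: subtract `n · g` until the remainder is at most `n · g`. The number
    -- `m` bounds the subtractions, which replaces an archimedean hypothesis.
    0≤c⇒Near : ∀ m {c} → 0# ≤ c → c ≤ m · (n · g) → Near c
    0≤c⇒Near zero    p q =
      Near-small (≤-trans (0≤x⇒∣x∣≤x p) (≤-trans q (0≤x⇒0≤n·x n 0≤g)))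
    0≤c⇒Near (suc m) {c} p q with total c (n · g)
    ... | inj₁ c≤ = Near-small (≤-trans (0≤x⇒∣x∣≤x p) c≤)
    ... | inj₂ ≤c = Near-shift (0≤c⇒Near m
      (≤-respˡ-≈ (inverseʳ (n · g)) (+-monoˡ-≤ (- (n · g)) ≤c))
      (≤-respʳ-≈ (xyx⁻¹≈y (n · g) (m · (n · g))) (+-monoˡ-≤ (- (n · g)) q)))

    ∣c∣≤⇒Near : ∀ m {c} → ∣ c ∣ ≤ m · (n · g) → Near c
    ∣c∣≤⇒Near m {c} p with ∣∣-sel c
    ... | inj₁ eq = Near-resp eq (0≤c⇒Near m (0≤∣x∣ c) p)
    ... | inj₂ eq =
      Near-resp (trans (-‿cong eq) (⁻¹-involutive c)) (Near-neg (0≤c⇒Near m (0≤∣x∣ c) p))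

  -- Convex subgroups in terms of absolute values.

  module _ (K : ConvexSubgroup G) where
    open ConvexSubgroup K hiding (Member)

    ∣∣-closed : ∀ {x} → x ∈ Member K → ∣ x ∣ ∈ Member K
    ∣∣-closed {x} p = [ (λ eq → resp (sym eq) p) , (λ eq → resp (sym eq) (-‿closed p)) ]′ (∣∣-sel x)

    ∣∣-convex : ∀ {x y} → ∣ x ∣ ≤ ∣ y ∣ → y ∈ Member K → x ∈ Member K
    ∣∣-convex {x} p q = convex
      (≤-respʳ-≈ (⁻¹-involutive x) (-‿anti-≤ (≤-trans (-x≤∣x∣ x) p))) (≤-trans (x≤∣x∣ x) p)
      (-‿closed (∣∣-closed q)) (∣∣-closed q)

    ∈∉⇒∣∣≤ : ∀ {x y} → x ∈ Member K → y ∉ Member K → ∣ x ∣ ≤ ∣ y ∣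
    ∈∉⇒∣∣≤ {x} {y} p q =
      [ (λ x≤y → x≤y) , (λ y≤x → contradiction (∣∣-convex y≤x p) q) ]′ (total ∣ x ∣ ∣ y ∣)

    ·-closed : ∀ n {x} → x ∈ Member K → n · x ∈ Member K
    ·-closed zero    p = 0-closed
    ·-closed (suc n) p = +-closed p (·-closed n p)

    -- Convex subgroups are pure, as `x` is dominated by `n · x`.
    ·-cancel : ∀ n .{{_ : NonZero n}} {x} → n · x ∈ Member K → x ∈ Member K
    ·-cancel n {x} = ∣∣-convex (∣x∣≤∣n·x∣ n x)

    -‿swap : ∀ {x y} → x - y ∈ Member K → y - x ∈ Member K
    -‿swap {x} {y} p = resp (⁻¹-anti-homo‿- x y) (-‿closed p)

    -‿cancelʳ : ∀ {x y} → x ∈ Member K → x - y ∈ Member K → y ∈ Member K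
    -‿cancelʳ {x} {y} p q = resp (x-[x-y]≈y x y) (+-closed p (-‿closed q))

  -- The convex subgroup generated by `a`: zero and all elements of valuation at least that of `a`.
  ⟪_⟫ : Carrier → ConvexSubgroup G
  ⟪ a ⟫ = record
    { Member   = λ x → ∃[ m ] ∣ x ∣ ≤ m · ∣ a ∣
    ; resp     = λ p (m , q) → m , ≤-respˡ-≈ (∣∣-cong p) q
    ; 0-closed = 0 , 0≤x⇒∣x∣≤x ≤-refl
    ; +-closed = λ {x} {y} (m , p) (k , q) → m ℕ.+ k ,
        ≤-trans (∣x+y∣≤∣x∣+∣y∣ x y) (≤-respʳ-≈ (sym (×-homo-+ ∣ a ∣ m k)) (+-mono-≤ p q))
    ; -‿closed = λ {x} (m , p) → m , ≤-respˡ-≈ (sym (∣-x∣≈∣x∣ x)) p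
    -- The bound for `z` controls `y` and the bound for `x` controls `- y`; the sum covers both
    -- without comparing `m` and `k`.
    ; convex   = λ {x} {y} {z} x≤y y≤z (m , p) (k , q) → m ℕ.+ k ,
        ≤-respʳ-≈ (sym (×-homo-+ ∣ a ∣ m k)) (∣∣-lub
          (≤-respˡ-≈ (identityˡ y)
            (+-mono-≤ (≤-trans (0≤∣x∣ x) p) (≤-trans y≤z (≤-trans (x≤∣x∣ z) q))))
          (≤-respˡ-≈ (identityʳ (- y))
            (+-mono-≤ (≤-trans (-‿anti-≤ x≤y) (≤-trans (-x≤∣x∣ x) p)) (≤-trans (0≤∣x∣ z) q))))
    }

  ∈⟪⟫-refl : ∀ a → a ∈ Member ⟪ a ⟫
  ∈⟪⟫-refl a = 1 , ∣x∣≤1·∣y∣ {a} {a} ≤-refl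

  ⟪⟫-least : ∀ K a → a ∈ Member K → ∀ {x} → x ∈ Member ⟪ a ⟫ → x ∈ Member K
  ⟪⟫-least K a p (m , q) =
    ∣∣-convex K (≤-trans q (x≤∣x∣ _)) (·-closed K m (∣∣-closed K p))

  -- Division with remainder for g = `∣ a ∣`. The bound is put as `∣ n · a ∣` so that it is the
  -- absolute value of a term and fits into a formula.
  near-multiple : ∀ n .{{_ : NonZero n}} {a c} → c ∈ Member ⟪ a ⟫ →
                  ∃[ z ] ∣ c - n · z ∣ ≤ ∣ n · a ∣
  near-multiple n {a} (m , p) with
    ∣c∣≤⇒Near n (0≤∣x∣ a) m (≤-trans p (·-monoʳ-≤ m (0≤x⇒x≤n·x n (0≤∣x∣ a))))
  ... | z , q = z , ≤-trans q (n·∣x∣≤∣n·x∣ n a)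

  ~-refl : ∀ a → _~_ G a a
  ~-refl a = 1 , s≤s z≤n , ∣x∣≤1·∣y∣ {a} {a} ≤-refl , ∣x∣≤1·∣y∣ {a} {a} ≤-refl

  ~⇒∈⟪⟫ˡ : ∀ a b → _~_ G a b → a ∈ Member ⟪ b ⟫
  ~⇒∈⟪⟫ˡ a b (n , _ , p , _) = n , p

  ~⇒∈⟪⟫ʳ : ∀ a b → _~_ G a b → b ∈ Member ⟪ a ⟫
  ~⇒∈⟪⟫ʳ a b (n , _ , _ , p) = n , p

  -- With its converse `∈⟪⟫⇒≼`, this turns the reversed order on archimedean classes into membership
  -- in generated subgroups.
  ≼⇒∈⟪⟫ : ∀ a b → _≼_ G a b → b ∈ Member ⟪ a ⟫
  ≼⇒∈⟪⟫ a b (inj₁ ((p , _) , _)) = 1 , ∣x∣≤1·∣y∣ p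
  ≼⇒∈⟪⟫ a b (inj₂ p)             = ~⇒∈⟪⟫ʳ a b p

  ∣∣≤∧∈⟪⟫⇒~ : ∀ {a b} → ∣ a ∣ ≤ ∣ b ∣ → b ∈ Member ⟪ a ⟫ → _~_ G a b
  ∣∣≤∧∈⟪⟫⇒~ {a} {b} p (m , q) =
    -- The successor is taken because `m` may be 0, while `_~_` asks for a positive factor.
    suc m , s≤s z≤n , ≤-trans p (0≤x⇒x≤n·x (suc m) (0≤∣x∣ b)) , ≤-trans q (n·∣x∣≤suc-n·∣x∣ m a)

  ∈⟪⟫⇒≼ : ExcludedMiddle ℓ → ∀ {a b} → b ∈ Member ⟪ a ⟫ → _≼_ G a b
  ∈⟪⟫⇒≼ em {a} {b} p with em {_~_ G a b}
  ... | yes a~b = inj₂ a~b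
  ... | no  a≁b with total ∣ b ∣ ∣ a ∣
  ...   | inj₁ b≤a =
    inj₁ ((b≤a , λ eq → a≁b (∣∣≤∧∈⟪⟫⇒~ {a} {b} (≤-reflexive (sym eq)) p)) , a≁b)
  ...   | inj₂ a≤b = contradiction (∣∣≤∧∈⟪⟫⇒~ {a} {b} a≤b p) a≁b

  -- Convex subgroups and divisibility in G / H and in quotients of H.

  module _ (H : ConvexSubgroup G) where
    private
      module H = ConvexSubgroup H

    pullback : ConvexSubgroup (G / H) → ConvexSubgroup G
    pullback C = record
      { Member   = Member C
      ; resp     = λ p → C.resp (H.resp (sym (x≈y⇒x∙y⁻¹≈ε p)) H.0-closed)
      ; 0-closed = C.0-closed
      ; +-closed = C.+-closed
      ; -‿closed = C.-‿closed
      ; convex   = λ p q → C.convex (≤⇒≤ᴴ p) (≤⇒≤ᴴ q)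
      }
      where
      module C = ConvexSubgroup C
      ≤⇒≤ᴴ : ∀ {x y} → x ≤ y → OrderedAbelianGroup._≤_ (G / H) x y
      ≤⇒≤ᴴ {y = y} p = 0# , H.0-closed , ≤-respʳ-≈ (sym (identityʳ y)) p

    pushforward : ∀ K → Member H ⊆ Member K → ConvexSubgroup (G / H)
    pushforward K H⊆K = record
      { Member   = Member K
      ; resp     = λ p q → -‿cancelʳ K q (H⊆K p)
      ; 0-closed = K.0-closed
      ; +-closed = K.+-closed
      ; -‿closed = K.-‿closed
      -- In `G` the element `y` lies between `x - h` and `z + k`, both in `K` because `H` is
      -- contained in `K`.
      ; convex   = λ {x} {y} (h , h∈H , x≤y+h) (k , k∈H , y≤z+k) x∈K z∈K → K.convex
          (≤-respʳ-≈ (x+y-y≈x y h) (+-monoˡ-≤ (- h) x≤y+h)) y≤z+k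
          (K.+-closed x∈K (K.-‿closed (H⊆K h∈H))) (K.+-closed z∈K (H⊆K k∈H))
      }
      where module K = ConvexSubgroup K

    divisible-pullback : ∀ n (C : ConvexSubgroup (G / H)) → Divisible n ⟨ C ⟩ →
                         ∀ {y} → y ∈ Member C → ∃[ z ] y - n · z ∈ Member H
    divisible-pullback n C div {y} y∈C with div (y , y∈C)
    ... | z , p = proj₁ z ,
      -‿swap H (≡.subst (λ w → w - y ∈ Member H) (·-homo ⟨ C ⟩ G proj₁ ≡.refl (λ _ _ → ≡.refl) n z) p)

    -- The divisor `z` may be sought in all of `G`: both `y` and `y - n · z` lie in `K`, hence so
    -- does `n · z`, and `z` follows by purity. The same argument, with `H` as the larger group,
    -- gives `restrict-divisible`.
    divisible-pushforward : ∀ n .{{_ : NonZero n}} K (H⊆K : Member H ⊆ Member K) →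
                            (∀ {y} → y ∈ Member K → ∃[ z ] y - n · z ∈ Member H) →
                            Divisible n ⟨ pushforward K H⊆K ⟩
    divisible-pushforward n K H⊆K div (y , y∈K) with div y∈K
    ... | z , p = z′ ,
      ≡.subst (λ w → w - y ∈ Member H)
        (≡.sym (·-homo ⟨ pushforward K H⊆K ⟩ G proj₁ ≡.refl (λ _ _ → ≡.refl) n z′)) (-‿swap H p)
      where z′ = z , ·-cancel K n {z} (-‿cancelʳ K {y} {n · z} y∈K (H⊆K {y - n · z} p))

    divisible-restrict : ∀ n (K : ConvexSubgroup G) → Divisible n (⟨ H ⟩ / (K ↾ H)) →
                         ∀ {y} → y ∈ Member H → ∃[ z ] y - n · z ∈ Member K
    divisible-restrict n K div {y} y∈H with div (y , y∈H)
    ... | z , p = proj₁ z ,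
      -‿swap K (≡.subst (λ w → w - y ∈ Member K)
        (·-homo (⟨ H ⟩ / (K ↾ H)) G proj₁ ≡.refl (λ _ _ → ≡.refl) n z) p)

    restrict-divisible : ∀ n .{{_ : NonZero n}} (K : ConvexSubgroup G) → Member K ⊆ Member H →
                         (∀ {y} → y ∈ Member H → ∃[ z ] y - n · z ∈ Member K) →
                         Divisible n (⟨ H ⟩ / (K ↾ H))
    restrict-divisible n K K⊆H div (y , y∈H) with div y∈H
    ... | z , p = z′ ,
      ≡.subst (λ w → w - y ∈ Member K)
        (≡.sym (·-homo (⟨ H ⟩ / (K ↾ H)) G proj₁ ≡.refl (λ _ _ → ≡.refl) n z′)) (-‿swap K p)
      where z′ = z , ·-cancel H n {z} (-‿cancelʳ H {y} {n · z} y∈H (K⊆H {y - n · z} p))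

-- Formulas for multiples and absolute values, and their meaning.

module _ {k : ℕ} where

  infixr 8 _⊡_
  _⊡_ : ℕ → Term k → Term k
  zero  ⊡ t = 𝟎
  suc n ⊡ t = t ⊕ (n ⊡ t)

  infixl 6 _⊖_
  _⊖_ : Term k → Term k → Term k
  s ⊖ t = s ⊕ (⊖ t)

  infix 4 _≤′_ ∣_∣≤′∣_∣
  _≤′_ : Term k → Term k → Formula k
  s ≤′ t = (s ⋖ t) ∨′ (s ≐ t)

  -- Absolute value is no symbol of the language. Since it equals `t` or `⊖ t`, the inequality says
  -- that one of these two bounds both `s` and `⊖ s`.
  ∣_∣≤′∣_∣ : Term k → Term k → Formula k
  ∣ s ∣≤′∣ t ∣ = ((s ≤′ t) ∧′ ((⊖ s) ≤′ t)) ∨′ ((s ≤′ (⊖ t)) ∧′ ((⊖ s) ≤′ (⊖ t)))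

module Definability (em : ExcludedMiddle ℓ) (G : OrderedAbelianGroup ℓ) where
  open GroupProperties G

  private
    dne = em⇒dne em

  ⊡-sem : ∀ {k} n (t : Term k) ρ → ⟦_⟧ G (n ⊡ t) ρ ≡ n · ⟦_⟧ G t ρ
  ⊡-sem zero    t ρ = ≡.refl
  ⊡-sem (suc n) t ρ = ≡.cong (⟦_⟧ G t ρ +_) (⊡-sem n t ρ)

  ⊖⊡-sem : ∀ {k} n (s t : Term k) ρ → ⟦_⟧ G (s ⊖ (n ⊡ t)) ρ ≡ ⟦_⟧ G s ρ - n · ⟦_⟧ G t ρ
  ⊖⊡-sem n s t ρ = ≡.cong (λ a → ⟦_⟧ G s ρ - a) (⊡-sem n t ρ)

  ≤′-sat : ∀ {k} (s t : Term k) {ρ} → Sat G (s ≤′ t) ρ ⇔ ⟦_⟧ G s ρ ≤ ⟦_⟧ G t ρ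
  ≤′-sat s t {ρ} = mk⇔ [ proj₁ , ≤-reflexive ]′ split
    where
    split : ⟦_⟧ G s ρ ≤ ⟦_⟧ G t ρ → Sat G (s ≤′ t) ρ
    split p with em {⟦_⟧ G s ρ ≈ ⟦_⟧ G t ρ}
    ... | yes q = inj₂ q
    ... | no  q = inj₁ (p , q)

  -- The equations admit terms containing `n ⊡ t`, whose value is a multiple only up to `≡` when `n`
  -- is a variable.
  ∣∣≤′∣∣-sat : ∀ {k} (s t : Term k) ρ {a b} → ⟦_⟧ G s ρ ≡ a → ⟦_⟧ G t ρ ≡ b →
               Sat G ∣ s ∣≤′∣ t ∣ ρ ⇔ ∣ a ∣ ≤ ∣ b ∣
  ∣∣≤′∣∣-sat s t ρ {a} {b} ≡.refl ≡.refl = mk⇔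
    [ (λ (p , q) → ≤-trans (∣∣-lub (to (≤′-sat s t) p) (to (≤′-sat (⊖ s) t) q)) (x≤∣x∣ b))
    , (λ (p , q) → ≤-trans (∣∣-lub (to (≤′-sat s (⊖ t)) p) (to (≤′-sat (⊖ s) (⊖ t)) q)) (-x≤∣x∣ b))
    ]′ λ p → [
      (λ eq → inj₁ ( from (≤′-sat s t) (≤-respʳ-≈ eq (≤-trans (x≤∣x∣ a) p))
                   , from (≤′-sat (⊖ s) t) (≤-respʳ-≈ eq (≤-trans (-x≤∣x∣ a) p))))
    , (λ eq → inj₂ ( from (≤′-sat s (⊖ t)) (≤-respʳ-≈ eq (≤-trans (x≤∣x∣ a) p))
                   , from (≤′-sat (⊖ s) (⊖ t)) (≤-respʳ-≈ eq (≤-trans (-x≤∣x∣ a) p))))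
    ]′ (∣∣-sel b)

  -- Criteria for the definability of H.

  module _ (H : ConvexSubgroup G) where

    -- Here z may range over all of G: by convexity c - n · z ∈ H forces z ∈ ⟪ a ⟫.
    ∃-non-multiple : ∀ n .{{_ : NonZero n}} →
      ¬ (Σ (ConvexSubgroup (G / H)) λ C → NonTrivial C × Divisible n ⟨ C ⟩) →
      ∀ {a} → a ∉ Member H → ∃[ c ] c ∈ Member ⟪ a ⟫ × (∀ z → c - n · z ∉ Member H)
    ∃-non-multiple n ¬div {a} a∉H = dne λ ¬∃ → ¬div
      ( pushforward H ⟪ a ⟫ H⊆⟪a⟫
      , (a , ∈⟪⟫-refl a , λ a-0∈H → a∉H (-‿cancel₀ a-0∈H))
      , divisible-pushforward H n ⟪ a ⟫ H⊆⟪a⟫ λ {c} c∈⟪a⟫ →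
          dne λ ¬z → ¬∃ (c , c∈⟪a⟫ , λ z p → ¬z (z , p)) )
      where
      H⊆⟪a⟫ : Member H ⊆ Member ⟪ a ⟫
      H⊆⟪a⟫ p = 1 , ∣x∣≤1·∣y∣ (∈∉⇒∣∣≤ H p a∉H)
      -‿cancel₀ : a - 0# ∈ Member H → a ∈ Member H
      -‿cancel₀ = ConvexSubgroup.resp H (trans (+-congˡ ε⁻¹≈ε) (identityʳ a))

    near-multiples⇒definable : ∀ n .{{_ : NonZero n}} →
      ¬ (Σ (ConvexSubgroup (G / H)) λ C → NonTrivial C × Divisible n ⟨ C ⟩) →
      ∀ {d} → d ∈ Member H → (∀ {y} → y ∈ Member H → ∃[ z ] ∣ y - n · z ∣ ≤ ∣ d ∣) →
      Definable G (Member H)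
    near-multiples⇒definable n ¬div {d} d∈H near = 1 , φ , d ∷ [] , λ x → mk⇔ (⇒ x) (⇐ x)
      where
      φ : Formula 2
      -- Under both quantifiers the variables are, from 0 on, the multiplier `z`, the tested `y`,
      -- the candidate `x` and the parameter `d`.
      φ = ∀′ (∣ var 0F ∣≤′∣ n ⊡ var 1F ∣ ⇒′ (∃′ ∣ var 1F ⊖ (n ⊡ var 0F) ∣≤′∣ var 3F ∣))

      bound : ∀ x y → Sat G ∣ var 0F ∣≤′∣ n ⊡ var 1F ∣ (y ∷ x ∷ d ∷ []) ⇔ ∣ y ∣ ≤ ∣ n · x ∣
      bound x y = ∣∣≤′∣∣-sat (var 0F) (n ⊡ var 1F) ρ ≡.refl (⊡-sem n (var 1F) ρ)
        where ρ = y ∷ x ∷ d ∷ []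

      dist : ∀ x y z → Sat G ∣ var 1F ⊖ (n ⊡ var 0F) ∣≤′∣ var 3F ∣ (z ∷ y ∷ x ∷ d ∷ [])
                     ⇔ ∣ y - n · z ∣ ≤ ∣ d ∣
      dist x y z = ∣∣≤′∣∣-sat (var 1F ⊖ (n ⊡ var 0F)) (var 3F) ρ (⊖⊡-sem n (var 1F) (var 0F) ρ) ≡.refl
        where ρ = z ∷ y ∷ x ∷ d ∷ []

      ⇒ : ∀ x → x ∈ Member H → Sat G φ (x ∷ d ∷ [])
      ⇒ x x∈H y p with near (∣∣-convex H (to (bound x y) p) (·-closed H n x∈H))
      ... | z , q = z , from (dist x y z) q

      ⇐ : ∀ x → Sat G φ (x ∷ d ∷ []) → x ∈ Member H
      ⇐ x sat = dne λ x∉H →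
        -- Test the formula at `c - n · z`, which is small enough and still outside nG + H; being
        -- within `∣ d ∣` of `n · w` would put `c - n · (z + w)` into `H`.
        let c , c∈⟪x⟫ , c∉nG+H = ∃-non-multiple n ¬div x∉H
            z , p = near-multiple n {x} {c} c∈⟪x⟫
            w , q = sat (c - n · z) (from (bound x (c - n · z)) p)
            eq    = trans (sym (x-[y+z]≈x-y-z c (n · z) (n · w)))
                          (+-congˡ (-‿cong (sym (×-distrib-+ z w n))))
        in c∉nG+H (z + w) (ConvexSubgroup.resp H eq
             (∣∣-convex H (to (dist x (c - n · z) w) q) d∈H))

    bounded-multiple⇒definable : ∀ n {g} → g ∉ Member H →
      (∀ {y} → ∣ n · y ∣ ≤ ∣ g ∣ → y ∈ Member H) → Definable G (Member H)
    bounded-multiple⇒definable n {g} g∉H small =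
      1 , ∣ n ⊡ var 0F ∣≤′∣ var 1F ∣ , g ∷ [] , λ x → mk⇔
        (λ x∈H → from (bound x) (∈∉⇒∣∣≤ H (·-closed H n x∈H) g∉H))
        (λ sat → small (to (bound x) sat))
      where
      bound : ∀ x → Sat G ∣ n ⊡ var 0F ∣≤′∣ var 1F ∣ (x ∷ g ∷ []) ⇔ ∣ n · x ∣ ≤ ∣ g ∣
      bound x = ∣∣≤′∣∣-sat (n ⊡ var 0F) (var 1F) ρ (⊡-sem n (var 0F) ρ) ≡.refl
        where ρ = x ∷ g ∷ []

    -- The distance of `c` to nG marks the cut at `H`: no element of `H` bounds any `c - n · z`,
    -- while each element outside `H` bounds one.
    approximable⇒definable : ∀ n {c} → (∀ z → c - n · z ∉ Member H) →
      (∀ {x} → x ∉ Member H → ∃[ z ] ∣ c - n · z ∣ ≤ ∣ x ∣) → Definable G (Member H)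
    approximable⇒definable n {c} c∉nG+H approx = 1 , φ , c ∷ [] , λ x → mk⇔
      (λ x∈H (z , p) → lift (c∉nG+H z (∣∣-convex H (to (dist x z) p) x∈H)))
      (λ sat → dne λ x∉H → let z , p = approx x∉H in lower (sat (z , from (dist x z) p)))
      where
      φ : Formula 2
      φ = (∃′ ∣ var 2F ⊖ (n ⊡ var 0F) ∣≤′∣ var 1F ∣) ⇒′ ⊥′

      dist : ∀ x z → Sat G ∣ var 2F ⊖ (n ⊡ var 0F) ∣≤′∣ var 1F ∣ (z ∷ x ∷ c ∷ [])
                   ⇔ ∣ c - n · z ∣ ≤ ∣ x ∣
      dist x z = ∣∣≤′∣∣-sat (var 2F ⊖ (n ⊡ var 0F)) (var 1F) ρ (⊖⊡-sem n (var 2F) (var 0F) ρ) ≡.refl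
        where ρ = z ∷ x ∷ c ∷ []

    dominated⇒definable : ∀ n .{{_ : NonZero n}} {c} → (∀ z → c - n · z ∉ Member H) →
      (∀ y → y ∉ Member H → c ∈ Member ⟪ y ⟫) → Definable G (Member H)
    dominated⇒definable n {c} c∉nG+H c∈⟪y⟫ = decide em
      where
      decide : Dec (∃[ g ] g ∉ Member H × (∀ y → ∣ n · y ∣ ≤ ∣ g ∣ → y ∈ Member H)) →
               Definable G (Member H)
      decide (yes (g , g∉H , small)) = bounded-multiple⇒definable n g∉H (λ {y} → small y)
      -- Now `x` itself fails as `g`, so some `y` outside `H` has `∣ n · y ∣` at most `∣ x ∣`, and
      -- `c` can be reduced modulo nG to that size.
      decide (no ¬small) = approximable⇒definable n {c} c∉nG+H λ {x} x∉H → dne λ ¬near →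
        ¬small (x , x∉H , λ y ny≤x → dne λ y∉H →
          let z , p = near-multiple n {y} {c} (c∈⟪y⟫ y y∉H)
          in ¬near (z , ≤-trans p ny≤x))

    -- The four cases.

    maximum⇒definable : ∀ n .{{_ : NonZero n}} →
      HasMaximum G (v[_∖0] G U ∖ v[_∖0] G (Member H)) →
      ¬ (Σ (ConvexSubgroup (G / H)) λ C → NonTrivial C × Divisible n ⟨ C ⟩) →
      Definable G (Member H)
    maximum⇒definable n (a , ((s , _ , s≉0 , s~a) , a∉Γᴴ) , a-max) ¬div =
      let c , c∈⟪a⟫ , c∉nG+H = ∃-non-multiple n ¬div a∉H
      in dominated⇒definable n c∉nG+H λ y y∉H → ⟪⟫-least ⟪ y ⟫ a (a∈⟪y⟫ y y∉H) {c} c∈⟪a⟫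
      where
      open ConvexSubgroup H using (resp; 0-closed)

      a∉H : a ∉ Member H
      a∉H a∈H = a∉Γᴴ (s , ⟪⟫-least H a a∈H {s} (~⇒∈⟪⟫ˡ s a s~a) , s≉0 , s~a)

      -- The class of `y` is not in Γ of `H`, as an equivalent `t` in `H` would force `y` into `H`;
      -- so maximality of `a` applies to it.
      a∈⟪y⟫ : ∀ y → y ∉ Member H → a ∈ Member ⟪ y ⟫
      a∈⟪y⟫ y y∉H = ≼⇒∈⟪⟫ y a (a-max y
        ( (y , tt , (λ y≈0 → y∉H (resp (sym y≈0) 0-closed)) , ~-refl y)
        , λ (t , t∈H , _ , t~y) → y∉H (⟪⟫-least H t t∈H {y} (~⇒∈⟪⟫ʳ t y t~y)) ))

    divisible⇒definable : ∀ n .{{_ : NonZero n}} →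
      (Σ (ConvexSubgroup (G / H)) λ C → NonTrivial C × Divisible n ⟨ C ⟩) →
      ¬ HasMinimum G (v[_∖0] G (Member H)) →
      ((H′ : ConvexSubgroup G) → Member H′ ⊂ Member H → ¬ Divisible n (⟨ H ⟩ / (H′ ↾ H))) →
      Definable G (Member H)
    divisible⇒definable n (C , (g , g∈C , g≉0) , C-div) ¬min ¬div =
      1 , φ , g ∷ [] , λ x → mk⇔ (⇒ x) (⇐ x)
      where
      open ConvexSubgroup H using (resp; 0-closed)

      ψ : Formula 3
      ψ = ∣ var 0F ∣≤′∣ var 2F ∣ ∧′ ((∃′ ∣ var 1F ⊖ (n ⊡ var 0F) ∣≤′∣ var 2F ∣) ⇒′ ⊥′)

      φ : Formula 2
      -- Zero has its own disjunct: when `H` is trivial, no `y` need satisfy `ψ` for `x` = 0.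
      φ = (var 0F ≐ 𝟎) ∨′ (∃′ ψ)

      bound : ∀ x y → Sat G ∣ var 0F ∣≤′∣ var 2F ∣ (y ∷ x ∷ g ∷ []) ⇔ ∣ y ∣ ≤ ∣ g ∣
      bound x y = ∣∣≤′∣∣-sat (var 0F) (var 2F) (y ∷ x ∷ g ∷ []) ≡.refl ≡.refl

      dist : ∀ x y z → Sat G ∣ var 1F ⊖ (n ⊡ var 0F) ∣≤′∣ var 2F ∣ (z ∷ y ∷ x ∷ g ∷ [])
                     ⇔ ∣ y - n · z ∣ ≤ ∣ x ∣
      dist x y z = ∣∣≤′∣∣-sat (var 1F ⊖ (n ⊡ var 0F)) (var 2F) ρ (⊖⊡-sem n (var 1F) (var 0F) ρ) ≡.refl
        where ρ = z ∷ y ∷ x ∷ g ∷ []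

      g∉H : g ∉ Member H
      g∉H = g≉0 ∘ resp (sym (trans (+-congˡ ε⁻¹≈ε) (identityʳ g)))

      -- If `⟪ x ⟫` were all of `H`, the class of `x` would be a minimum.
      ⟪⟫⊂H : ∀ {x} → x ∈ Member H → ¬ x ≈ 0# → Member ⟪ x ⟫ ⊂ Member H
      ⟪⟫⊂H {x} x∈H x≉0 = ⟪⟫-least H x x∈H , λ H⊆⟪x⟫ → ¬min
        (x , (x , x∈H , x≉0 , ~-refl x) , λ b (s , s∈H , _ , s~b) →
          ∈⟪⟫⇒≼ em {x} {b} (⟪⟫-least ⟪ x ⟫ s (H⊆⟪x⟫ {s} s∈H) {b} (~⇒∈⟪⟫ʳ s b s~b)))

      ⇒ : ∀ x → x ∈ Member H → Sat G φ (x ∷ g ∷ [])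
      ⇒ x x∈H with em {x ≈ 0#}
      ... | yes x≈0 = inj₁ x≈0
      -- Failure of divisibility modulo `⟪ x ⟫` yields `y` in `H` outside nG + `⟪ x ⟫`, so not
      -- within `∣ x ∣` of nG; and `∣ y ∣` is at most `∣ g ∣` as `g` is outside `H`.
      ... | no  x≉0 = inj₂ (dne λ ¬∃ → ¬div ⟪ x ⟫ (⟪⟫⊂H x∈H x≉0)
        (restrict-divisible H n ⟪ x ⟫ (⟪⟫-least H x x∈H) λ {y} y∈H → dne λ ¬near →
          ¬∃ ( y , from (bound x y) (∈∉⇒∣∣≤ H y∈H g∉H)
             , λ (z , p) → lift (¬near
                 (z , ∣∣-convex ⟪ x ⟫ (to (dist x y z) p) (∈⟪⟫-refl x))))))

      ⇐ : ∀ x → Sat G φ (x ∷ g ∷ []) → x ∈ Member H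
      ⇐ x (inj₁ x≈0)         = resp (sym x≈0) 0-closed
      -- By convexity `y` lies in the preimage of `C`, hence in nG + `H`; an `x` outside `H` would
      -- bound the remainder, against `q`.
      ⇐ x (inj₂ (y , p , q)) = dne λ x∉H →
        let z , y-nz∈H = divisible-pullback H n C C-div
                           (∣∣-convex (pullback H C) (to (bound x y) p) g∈C)
        in lower (q (z , from (dist x y z) (∈∉⇒∣∣≤ H y-nz∈H x∉H)))

    minimum⇒definable : ∀ n .{{_ : NonZero n}} →
      ¬ (Σ (ConvexSubgroup (G / H)) λ C → NonTrivial C × Divisible n ⟨ C ⟩) →
      HasMinimum G (v[_∖0] G (Member H)) → Definable G (Member H)
    minimum⇒definable n ¬div (a , (s , s∈H , _ , s~a) , a-min) =
      -- A minimum `a` generates `H` as a convex subgroup, so d = `n · a` serves as the uniform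
      -- bound.
      near-multiples⇒definable n ¬div (·-closed H n {a} (⟪⟫-least H s s∈H {a} (~⇒∈⟪⟫ʳ s a s~a)))
        (λ {y} y∈H → near-multiple n {a} {y} (H⊆⟪a⟫ y∈H))
      where
      H⊆⟪a⟫ : Member H ⊆ Member ⟪ a ⟫
      H⊆⟪a⟫ {y} y∈H with em {y ≈ 0#}
      ... | yes y≈0 = ConvexSubgroup.resp ⟪ a ⟫ (sym y≈0) (ConvexSubgroup.0-closed ⟪ a ⟫)
      ... | no  y≉0 = ≼⇒∈⟪⟫ a y (a-min y (y , y∈H , y≉0 , ~-refl y))

    divisible-quotient⇒definable : ∀ n .{{_ : NonZero n}} →
      ¬ (Σ (ConvexSubgroup (G / H)) λ C → NonTrivial C × Divisible n ⟨ C ⟩) →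
      ∀ H′ → Member H′ ⊂ Member H → Divisible n (⟨ H ⟩ / (H′ ↾ H)) → Definable G (Member H)
    -- Any `d` in `H` outside `H′` is a uniform bound, since remainders modulo nG can be chosen in
    -- `H′`. Properness only denies an inclusion, so `d` is obtained by contradiction.
    divisible-quotient⇒definable n ¬div H′ (_ , H⊈H′) div = dne λ ¬def →
      H⊈H′ λ {d} d∈H → dne λ d∉H′ → ¬def
        (near-multiples⇒definable n ¬div d∈H λ y∈H →
          let z , y-nz∈H′ = divisible-restrict H n H′ div y∈H
          in z , ∈∉⇒∣∣≤ H′ y-nz∈H′ d∉H′)

open import Data.Nat.Base using (_≤_)

corollary4p8 :
  ∀ {ℓ} → ExcludedMiddle ℓ →
  (G : OrderedAbelianGroup ℓ) (H : ConvexSubgroup G) →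
  Member H ⊂ U →
  let Γ  = v[_∖0] G U
      Γᴴ = v[_∖0] G (Member H)
      HasDivisibleConvexSubgroup = λ n →
        Σ (ConvexSubgroup (G / H)) λ C → NonTrivial C × Divisible n ⟨ C ⟩
  in
  ( HasMaximum G (Γ ∖ Γᴴ) →
    (∃[ n ] 2 ≤ n × ¬ HasDivisibleConvexSubgroup n) →
    Definable G (Member H) )
  ×
  ( (∃[ n ] 2 ≤ n
      × HasDivisibleConvexSubgroup n
      × ¬ HasMinimum G Γᴴ
      × ((H′ : ConvexSubgroup G) → Member H′ ⊂ Member H →
           ¬ Divisible n (⟨ H ⟩ / (H′ ↾ H)))) →
    Definable G (Member H) )
  ×
  ( (∃[ n ] 2 ≤ n
      × ¬ HasDivisibleConvexSubgroup n
      × HasMinimum G Γᴴ) →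
    Definable G (Member H) )
  ×
  ( (∃[ n ] 2 ≤ n
      × ¬ HasDivisibleConvexSubgroup n
      × Σ (ConvexSubgroup G) λ H′ → Member H′ ⊂ Member H
          × Divisible n (⟨ H ⟩ / (H′ ↾ H))) →
    Definable G (Member H) )
corollary4p8 em G H _ =
    -- The bound `2 ≤ n` rules out zero, and the pattern `suc n` provides the `NonZero` instance.
    (λ { max (suc n , _ , ¬div) → maximum⇒definable H (suc n) max ¬div })
  , (λ { (suc n , _ , div , ¬min , ¬div) → divisible⇒definable H (suc n) div ¬min ¬div })
  , (λ { (suc n , _ , ¬div , min) → minimum⇒definable H (suc n) ¬div min })
  , (λ { (suc n , _ , ¬div , H′ , H′⊂H , div) →
           divisible-quotient⇒definable H (suc n) ¬div H′ H′⊂H div })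
  where open Definability em G
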